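{- Each column of the forward adjacency matrix $\mathbf{A}$ has at most two non-zero entries: one is the diagonal entry, which is $1$, while the other (if present) is $-1$.
   Context: Let $G$ be a finite tree (connected acyclic simple graph) with nodes $n_0,n_1,\dots,n_N$, $N\ge 1$, where $n_0$ is a terminal node (degree one) and the nodes are indexed so that along the path in $G$ from $n_0$ to any node $n_i$ the successively encountered node indices strictly increase. Node $n_i$ is forward-adjacent to $n_k$ if $n_i$ and $n_k$ are adjacent and $i<k$. The forward adjacency matrix $\mathbf{A}$ of $G$ is the $N\times N$ matrix, with rows and columns indexed by $1,\dots,N$, given by $\mathbf{A}(i,j)=1$ if $i=j$, $\mathbf{A}(i,j)=-1$ if $n_i$ is forward-adjacent to $n_j$, and $\mathbf{A}(i,j)=0$ otherwise. -}

module Defs where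

open import Data.Bool.Base using (if_then_else_)
open import Data.Fin.Base using (Fin; zero; suc; _<_)
open import Data.Fin.Properties using (_≟_; _<?_)
open import Data.Integer.Base using (ℤ; 0ℤ; 1ℤ; -1ℤ)
import Data.Integer.Properties as ℤ
open import Data.List.Base using (List; []; _∷_; length; filter; allFin)
open import Data.List.Relation.Unary.Linked using (Linked)
open import Data.List.Relation.Unary.Unique.Propositional using (Unique)
open import Data.Nat.Base using (ℕ; suc; _≥_)
open import Data.Product.Base using (Σ-syntax; _×_)
open import Data.Vec.Functional using (Vector)
open import Relation.Binary.Construct.Closure.ReflexiveTransitive
  using (Star; ε; _◅_)
open import Relation.Binary.Core using (Rel)
open import Relation.Binary.Definitions
  using (Symmetric; Irreflexive; Decidable)
open import Relation.Binary.PropositionalEquality.Core using (_≡_)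
open import Relation.Nullary.Decidable.Core using (does; _×-dec_; ¬?)
open import Relation.Nullary.Negation.Core using (¬_)
open import Level using (0ℓ)

-- A graph with n nodes has the node set Fin n, so that a node of the graph
-- and its index are the same thing.

record SimpleGraph (n : ℕ) : Set₁ where
  field
    Adj        : Rel (Fin n) 0ℓ
    adj?       : Decidable Adj
    adj-sym    : Symmetric Adj
    adj-irrefl : Irreflexive _≡_ Adj

module _ {n : ℕ} (G : SimpleGraph n) where
  open SimpleGraph G

  degree : Fin n → ℕ
  degree v = length (filter (adj? v) (allFin n))

  Terminal : Fin n → Set
  Terminal v = degree v ≡ 1

  Walk : Rel (Fin n) 0ℓ
  Walk = Star Adj

  -- The nodes encountered along a walk, both end points included.

  nodes : ∀ {u v} → Walk u v → List (Fin n)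
  nodes {u} ε       = u ∷ []
  nodes {u} (_ ◅ w) = u ∷ nodes w

  IsPath : ∀ {u v} → Walk u v → Set
  IsPath w = Unique (nodes w)

  Connected : Set
  Connected = ∀ u v → Σ[ w ∈ Walk u v ] IsPath w

  -- A cycle is a path on at least three nodes together with an edge from
  -- its last node back to its first.

  record Cycle : Set where
    field
      {first last} : Fin n
      walk         : Walk first last
      isPath       : IsPath walk
      atLeast3     : length (nodes walk) ≥ 3
      closing      : Adj last first

  Acyclic : Set
  Acyclic = ¬ Cycle

  record IsTree : Set where
    field
      connected : Connected
      acyclic   : Acyclic

  ForwardAdjacent : Rel (Fin n) 0ℓ
  ForwardAdjacent i k = Adj i k × i < k

  forwardAdjacent? : Decidable ForwardAdjacent
  forwardAdjacent? i k = adj? i k ×-dec (i <? k)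

IncreasingIndices : ∀ {N} → SimpleGraph (suc N) → Set
IncreasingIndices G =
  ∀ i (w : Walk G zero i) → IsPath G w → Linked _<_ (nodes G w)

Matrix : Set → ℕ → ℕ → Set
Matrix A m n = Vector (Vector A n) m

column : ∀ {A m n} → Matrix A m n → Fin n → Vector A m
column M j i = M i j

-- Fin N numbers the rows and columns from 0, whereas the node zero has no
-- row or column: position i : Fin N belongs to the node suc i.

forwardAdjacencyMatrix : ∀ {N} → SimpleGraph (suc N) → Matrix ℤ N N
forwardAdjacencyMatrix G i j =
  if does (i ≟ j) then 1ℤ
  else if does (forwardAdjacent? G (suc i) (suc j)) then -1ℤ
  else 0ℤ

nonZeroPositions : ∀ {n} → Vector ℤ n → List (Fin n)
nonZeroPositions {n} x = filter (λ i → ¬? (x i ℤ.≟ 0ℤ)) (allFin n)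

{-# OPTIONS --safe #-}
module Submission where

open import Defs
open import Data.Bool.Base using (if_then_else_)
open import Data.Fin.Base using (Fin; zero; suc; _<_)
open import Data.Fin.Properties using (_≟_; <-trans; <-irrefl; suc-injective)
open import Data.Integer.Base using (0ℤ; 1ℤ; -1ℤ)
import Data.Integer.Properties as ℤ
open import Data.List.Base using (List; []; _∷_; length; allFin)
open import Data.List.Membership.Propositional using (_∈_)
open import Data.List.Relation.Unary.All as All using (All; []; _∷_)
open import Data.List.Relation.Unary.All.Properties using (all-filter; ¬Any⇒All¬)
open import Data.List.Relation.Unary.AllPairs using ([]; _∷_)
open import Data.List.Relation.Unary.Any using (here; there; any?)
open import Data.List.Relation.Unary.Linked using (Linked; [-]; _∷_)
open import Data.List.Relation.Unary.Unique.Propositional using (Unique)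
open import Data.List.Relation.Unary.Unique.Propositional.Properties using (allFin⁺; filter⁺)
open import Data.Nat.Base using (ℕ; suc; _≤_; _≥_; z≤n; s≤s)
open import Data.Product.Base using (_×_; _,_; proj₁; proj₂; Σ-syntax)
open import Data.Sum.Base using (_⊎_; inj₁; inj₂; map₂)
open import Function.Base using (_∘_)
open import Relation.Binary.Construct.Closure.ReflexiveTransitive
  using (Star; ε; _◅_; _◅◅_; reverse)
open import Relation.Binary.Core using (Rel)
open import Relation.Binary.PropositionalEquality.Core using (_≡_; _≢_; refl; sym; trans)
open import Relation.Nullary.Decidable.Core using (Dec; yes; no; does; ¬?; decidable-stable)
open import Relation.Nullary.Decidable using (dec-true)
open import Relation.Nullary.Negation.Core using (contradiction)
open import Relation.Unary using (Pred)
open import Level using (0ℓ)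

-- Two forward neighbours a ≢ b of n_k are both joined to n_0 by paths with
-- increasing indices, hence through nodes of index below k.  So a and b are
-- joined by a path avoiding n_k, which n_k closes up to a cycle.

module _ {n : ℕ} (G : SimpleGraph n) where
  open SimpleGraph G

  AdjWithin : Pred (Fin n) 0ℓ → Rel (Fin n) 0ℓ
  AdjWithin P u v = Adj u v × P u × P v

  record PathWithin (P : Pred (Fin n) 0ℓ) (u v : Fin n) : Set where
    constructor pathWithin
    field
      walk   : Walk G u v
      isPath : IsPath G walk
      within : All P (nodes G walk)

  suffixFrom : ∀ {P u v x} (p : PathWithin P u v) →
               x ∈ nodes G (PathWithin.walk p) → PathWithin P x v
  suffixFrom p@(pathWithin ε _ _) (here refl) = p
  suffixFrom p@(pathWithin (_ ◅ _) _ _) (here refl) = p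
  suffixFrom (pathWithin (_ ◅ w) (_ ∷ uniq) (_ ∷ within)) (there x∈w) =
    suffixFrom (pathWithin w uniq within) x∈w

  loopErase : ∀ {P u v} → P v → Star (AdjWithin P) u v → PathWithin P u v
  loopErase pv ε = pathWithin ε ([] ∷ []) (pv ∷ [])
  loopErase {u = u} pv ((adj , pu , _) ◅ w) with loopErase pv w
  ... | p@(pathWithin walk isPath within) with any? (u ≟_) (nodes G walk)
  ...   | yes u∈walk = suffixFrom p u∈walk
  ...   | no  u∉walk =
    pathWithin (adj ◅ walk) (¬Any⇒All¬ _ u∉walk ∷ isPath) (pu ∷ within)

  increasing⇒below : ∀ {u v k} (w : Walk G u v) → Linked _<_ (nodes G w) →
                     v < k → u < k × Star (AdjWithin (_< k)) u v
  increasing⇒below ε _ v<k = v<k , ε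
  increasing⇒below (e ◅ ε) (u<v ∷ _) v<k =
    <-trans u<v v<k , (e , <-trans u<v v<k , v<k) ◅ ε
  increasing⇒below (e ◅ w@(_ ◅ _)) (u<x ∷ inc) v<k
    with increasing⇒below w inc v<k
  ... | x<k , w′ = <-trans u<x x<k , (e , <-trans u<x x<k , x<k) ◅ w′

  length-nodes≥1 : ∀ {u v} (w : Walk G u v) → length (nodes G w) ≥ 1
  length-nodes≥1 ε       = s≤s z≤n
  length-nodes≥1 (_ ◅ _) = s≤s z≤n

  length-nodes≥2 : ∀ {u v} → u ≢ v → (w : Walk G u v) → length (nodes G w) ≥ 2
  length-nodes≥2 u≢u ε     = contradiction refl u≢u
  length-nodes≥2 _ (_ ◅ w) = s≤s (length-nodes≥1 w)

  pathBelow⇒cycle : ∀ {a b k} → a ≢ b → Adj a k → Adj b k →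
                    PathWithin (_< k) a b → Cycle G
  pathBelow⇒cycle a≢b a~k b~k (pathWithin walk isPath below) = record
    { walk     = adj-sym a~k ◅ walk
    ; isPath   = All.map (λ x<k k≡x → <-irrefl (sym k≡x) x<k) below ∷ isPath
    ; atLeast3 = s≤s (length-nodes≥2 a≢b walk)
    ; closing  = b~k
    }

forwardAdjacent-unique : ∀ {N} (G : SimpleGraph (suc N)) → IsTree G →
                         IncreasingIndices G → ∀ {a b k} →
                         ForwardAdjacent G a k → ForwardAdjacent G b k → a ≡ b
forwardAdjacent-unique G tree inc {a} {b} {k} (a~k , a<k) (b~k , b<k) =
  decidable-stable (a ≟ b) λ a≢b →
    acyclic (pathBelow⇒cycle G a≢b a~k b~k
      (loopErase G b<k (reverse swap (fromRoot a<k) ◅◅ fromRoot b<k)))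
  where
  open IsTree tree
  open SimpleGraph G

  swap : ∀ {u v} → AdjWithin G (_< k) u v → AdjWithin G (_< k) v u
  swap (u~v , pu , pv) = adj-sym u~v , pv , pu

  fromRoot : ∀ {v} → v < k → Star (AdjWithin G (_< k)) zero v
  fromRoot {v} v<k with connected zero v
  ... | w , isPath = proj₂ (increasing⇒below G w (inc v w isPath) v<k)

unique-length≤2 : ∀ {A : Set} {Q : Pred A 0ℓ} {j} →
                  (∀ {x y} → Q x → Q y → x ≡ y) →
                  ∀ {xs} → Unique xs → All (λ x → x ≡ j ⊎ Q x) xs →
                  length xs ≤ 2
unique-length≤2 Q-unique {[]}         _ _ = z≤n
unique-length≤2 Q-unique {_ ∷ []}     _ _ = s≤s z≤n
unique-length≤2 Q-unique {_ ∷ _ ∷ []} _ _ = s≤s (s≤s z≤n)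
unique-length≤2 {Q = Q} {j} Q-unique {x ∷ y ∷ z ∷ _}
  ((x≢y ∷ x≢z ∷ _) ∷ (y≢z ∷ _) ∷ _) (px ∷ py ∷ pz ∷ _) =
  contradiction px λ
    { (inj₁ x≡j) → y≢z (Q-unique (other x≢y x≡j py) (other x≢z x≡j pz))
    ; (inj₂ qx)  → y≢z (trans (base x≢y qx py) (sym (base x≢z qx pz)))
    }
  where
  other : ∀ {u v} → u ≢ v → u ≡ j → v ≡ j ⊎ Q v → Q v
  other u≢v u≡j (inj₁ v≡j) = contradiction (trans u≡j (sym v≡j)) u≢v
  other _   _   (inj₂ qv)  = qv

  base : ∀ {u v} → u ≢ v → Q u → v ≡ j ⊎ Q v → v ≡ j
  base _   _  (inj₁ v≡j) = v≡j
  base u≢v qu (inj₂ qv)  = contradiction (Q-unique qu qv) u≢v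

entry-nonZero : ∀ {P Q : Set} (p? : Dec P) (q? : Dec Q) →
                let e = if does p? then 1ℤ else if does q? then -1ℤ else 0ℤ in
                e ≢ 0ℤ → P ⊎ (Q × e ≡ -1ℤ)
entry-nonZero (yes p) _       _   = inj₁ p
entry-nonZero (no _)  (yes q) _   = inj₂ (q , refl)
entry-nonZero (no _)  (no _)  0≢0 = contradiction refl 0≢0

lemma3 : (N : ℕ) → N ≥ 1 →
    (G : SimpleGraph (suc N)) → IsTree G →
    Terminal G zero → IncreasingIndices G →
    (j : Fin N) →
    let c = column (forwardAdjacencyMatrix G) j in
    length (nonZeroPositions c) ≤ 2
    × c j ≡ 1ℤ
    × ((i : Fin N) → i ≢ j → c i ≢ 0ℤ → c i ≡ -1ℤ)
lemma3 N _ G tree _ inc j = atMostTwo , diagonal , offDiagonal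
  where
  c = column (forwardAdjacencyMatrix G) j

  nonZero-cases : ∀ i → c i ≢ 0ℤ →
                  i ≡ j ⊎ (ForwardAdjacent G (suc i) (suc j) × c i ≡ -1ℤ)
  nonZero-cases i = entry-nonZero (i ≟ j) (forwardAdjacent? G (suc i) (suc j))

  nonZero? = λ i → ¬? (c i ℤ.≟ 0ℤ)

  atMostTwo : length (nonZeroPositions c) ≤ 2
  atMostTwo = unique-length≤2
    (λ p q → suc-injective (forwardAdjacent-unique G tree inc p q))
    (filter⁺ nonZero? (allFin⁺ N))
    (All.map (λ {i} → map₂ proj₁ ∘ nonZero-cases i)
             (all-filter nonZero? (allFin N)))

  diagonal : c j ≡ 1ℤ
  diagonal rewrite dec-true (j ≟ j) refl = refl

  offDiagonal : ∀ i → i ≢ j → c i ≢ 0ℤ → c i ≡ -1ℤ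
  offDiagonal i i≢j ci≢0 with nonZero-cases i ci≢0
  ... | inj₁ i≡j         = contradiction i≡j i≢j
  ... | inj₂ (_ , ci≡-1) = ci≡-1
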